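{- Let $n,m,c$ be natural numbers with $c\leq\min\{n,m\}+1$. Among all formal contexts with exactly $n$ objects and exactly $m$ attributes which do not contain a contranominal scale of size $c$ as a subcontext, there exists one with the maximum number of formal concepts which contains a contranominal scale of size $c-1$ as a subcontext.
   Context: A formal context is a triple $(G,M,I)$ with $I\subseteq G\times M$; its formal concepts are the pairs $(A,B)$ with $A\subseteq G$, $B\subseteq M$, $A^I=B$, $B^I=A$, where $A^I=\{n\in M:(a,n)\in I\ \forall a\in A\}$ and dually. The contranominal scale of size $j$ is the context $(\{1,\dots,j\},\{1,\dots,j\},\neq)$. A context contains a context $\mathbb{S}$ as a subcontext if for some $H\subseteq G$, $N\subseteq M$ the context $(H,N,I\cap(H\times N))$ is isomorphic to $\mathbb{S}$. -}

module Defs where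

open import Data.Bool using (Bool; true; false; _∨_; not)
open import Data.Bool.Properties using () renaming (_≟_ to _≟ᵇ_)
open import Data.Nat using (ℕ; zero; suc)
open import Data.Fin using (Fin)
open import Data.Vec using (Vec; []; _∷_; tabulate; lookup)
open import Data.Vec.Properties using (≡-dec)
open import Data.List using (List; []; _∷_; map; _++_; length; allFin; filter; cartesianProduct)
open import Data.Product using (Σ; _×_; _,_; ∃)
open import Relation.Binary.PropositionalEquality using (_≡_; _≢_)
open import Relation.Nullary using (Dec; yes; no; _×-dec_)
open import Function.Definitions using (Injective)
open import Data.Bool.ListAction using (and)

-- A formal context with object set Fin n and attribute set Fin m:
-- the incidence relation I ⊆ G × M, given as its characteristic function.
Context : ℕ → ℕ → Set
Context n m = Fin n → Fin m → Bool

Subset : ℕ → Set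
Subset k = Vec Bool k

allSubsets : (k : ℕ) → List (Subset k)
allSubsets zero    = [] ∷ []
allSubsets (suc k) = map (true ∷_) (allSubsets k) ++ map (false ∷_) (allSubsets k)

up : ∀ {n m} → Context n m → Subset n → Subset m
up {n} I A = tabulate λ y → and (map (λ x → not (lookup A x) ∨ I x y) (allFin n))

down : ∀ {n m} → Context n m → Subset m → Subset n
down {n} {m} I B = tabulate λ x → and (map (λ y → not (lookup B y) ∨ I x y) (allFin m))

IsConcept : ∀ {n m} → Context n m → Subset n × Subset m → Set
IsConcept I (A , B) = (up I A ≡ B) × (down I B ≡ A)

isConcept? : ∀ {n m} (I : Context n m) (p : Subset n × Subset m) → Dec (IsConcept I p)
isConcept? I (A , B) = ≡-dec _≟ᵇ_ (up I A) B ×-dec ≡-dec _≟ᵇ_ (down I B) A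

numConcepts : ∀ {n m} → Context n m → ℕ
numConcepts {n} {m} I =
  length (filter (isConcept? I) (cartesianProduct (allSubsets n) (allSubsets m)))

-- The context contains the contranominal scale of size j as a subcontext:
-- there are H ⊆ G, N ⊆ M with bijections f : {1..j} → H, g : {1..j} → N
-- such that (f a , g b) ∈ I iff a ≠ b.  (Equivalently: injections into G, M.)
ContainsContranominal : ∀ {n m} → ℕ → Context n m → Set
ContainsContranominal {n} {m} j I =
  Σ (Fin j → Fin n) λ f → Σ (Fin j → Fin m) λ g →
    Injective _≡_ _≡_ f × Injective _≡_ _≡_ g ×
    (∀ a b → (I (f a) (g b) ≡ true → a ≢ b) × (a ≢ b → I (f a) (g b) ≡ true))

{-# OPTIONS --safe #-}
module Submission where

-- Fix an attribute x of a context I. There is an object g such that deleting g and x leaves at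
-- least half of the concepts: if x is missing from some object, then, on average over the objects
-- g missing x, the concepts of I inject into two copies of those of I − g − x.
-- Conversely, adjoining an object and an attribute that are incident to everything except each
-- other doubles the number of concepts and raises the largest contranominal scale by exactly one.
-- So a context whose contranominal scales are too small can be traded, by deleting (g, x),
-- improving the rest by induction and adjoining a new pair, for one with at least as many concepts
-- and with a contranominal scale of the desired size. Apply this to a maximal context.

open import Defs
open import Data.Nat using (ℕ; _≤_; _∸_; _+_; _⊓_)
open import Data.Product using (Σ; _×_)
open import Relation.Nullary using (¬_)

open import Data.Bool using (Bool; true; false; _∨_; _∧_; not)
open import Data.Bool.Properties using (¬-not; not-¬; ∧-conicalˡ; ∧-conicalʳ) renaming (_≟_ to _≟ᵇ_)
open import Data.Bool.ListAction using (and)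
open import Data.Fin using (Fin; zero; suc; punchIn; combine; remQuot; finToFun; funToFin)
open import Data.Fin.Properties using
  ( _≟_; any?; all?; suc-injective; punchInᵢ≢i; punchIn-injective; punchIn-punchOut
  ; remQuot-combine; finToFun-funToFin )
open import Data.Fin.Subset using (_∈_; _⊆_; _∩_; _∪_; ∁; ⁅_⁆)
open import Data.Fin.Subset.Properties using
  ( _∈?_; ⊆-antisym; x∈p∩q⁺; x∈p∩q⁻; x∈p∪q⁺; x∈p∪q⁻; x∈⁅x⁆; x∈⁅y⁆⇒x≡y
  ; x∈∁p⇒x∉p; x∉p⇒x∈∁p; anySubset?; x≢y⇒x∉⁅y⁆ )
open import Data.List using (List; []; _∷_; map; _++_; length; allFin; filter; concatMap; cartesianProduct)
open import Data.List.Extrema.Nat using (argmax; argmax-all; f[xs]≤f[argmax])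
open import Data.List.Membership.Propositional using (lose) renaming (_∈_ to _∈ˡ_)
open import Data.List.Membership.Propositional.Properties using
  ( ∈-∃++; ∈-++⁺ˡ; ∈-++⁺ʳ; ∈-++⁻; ∈-map⁺; ∈-map⁻; ∈-filter⁺; ∈-filter⁻
  ; ∈-cartesianProduct⁺; ∈-cartesianProduct⁻; ∈-allFin; ∈-concatMap⁺ )
open import Data.List.Properties using (length-++; length-map; ++-identityʳ)
open import Data.List.Relation.Unary.All as All using ([]; _∷_)
open import Data.List.Relation.Unary.All.Properties using (all-filter)
open import Data.List.Relation.Unary.Any using (here; there)
open import Data.List.Relation.Unary.AllPairs using ([]; _∷_)
open import Data.List.Relation.Unary.Unique.Propositional using (Unique)
open import Data.List.Relation.Unary.Unique.Propositional.Properties as Uniqueₚ using ()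
open import Data.Nat using (zero; suc; _*_; z≤n; s≤s)
open import Data.Nat.Properties using
  ( ≤-refl; ≤-trans; ≤-reflexive; ≰⇒>; ≤-pred; _≤?_; +-suc; +-mono-<; +-identityʳ; +-comm
  ; *-monoʳ-≤; <⇒≱; ≮⇒≥; m⊓n≤m; m⊓n≤n; module ≤-Reasoning )
open import Data.Product using (_,_; proj₁; proj₂; ∃; ∃₂; uncurry)
open import Data.Sum using (inj₁; inj₂)
open import Data.Vec using ([]; _∷_; here; there; tabulate; lookup; tail)
open import Data.Vec.Properties using
  (≡-dec; lookup∘tabulate; []=⇒lookup; lookup⇒[]=; ∷-injectiveˡ; ∷-injectiveʳ)
open import Function using (_∘_; case_of_; flip)
open import Relation.Binary.PropositionalEquality using
  (_≡_; _≢_; refl; sym; trans; cong; cong₂; subst; subst₂; module ≡-Reasoning)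
open import Relation.Nullary using (Dec; yes; no; contradiction; _×-dec_; _→-dec_; ¬?)
open import Relation.Nullary.Decidable using (map′; decidable-stable)
open import Relation.Unary using (Decidable)

-- Counting

-- Cut a partner `y` of the first element out of `ys`. By injectivity no later element is related to
-- `y`, so the partners of the rest lie in `as ++ bs`. A relation instead of a function lets each
-- pair carry the reason for its choice, on which injectivity can then rely.
length-≤ : ∀ {a b r} {A : Set a} {B : Set b} (R : A → B → Set r) {xs : List A} {ys : List B} →
  Unique xs →
  (∀ {x} → x ∈ˡ xs → ∃ λ y → y ∈ˡ ys × R x y) →
  (∀ {x x′ y} → R x y → R x′ y → x ≡ x′) →
  length xs ≤ length ys
length-≤ R {[]} _ _ _ = z≤n
length-≤ R {x ∷ xs} (x≢ ∷ uniq) total inj with total (here refl)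
... | y , y∈ys , Rxy with ∈-∃++ y∈ys
... | as , bs , refl = begin
  suc (length xs)              ≤⟨ s≤s (length-≤ R uniq total′ inj) ⟩
  suc (length (as ++ bs))      ≡⟨ cong suc (length-++ as) ⟩
  suc (length as + length bs)  ≡⟨ +-suc (length as) (length bs) ⟨
  length as + suc (length bs)  ≡⟨ length-++ as ⟨
  length (as ++ y ∷ bs)        ∎
  where
  open ≤-Reasoning
  total′ : ∀ {x′} → x′ ∈ˡ xs → ∃ λ y′ → y′ ∈ˡ as ++ bs × R x′ y′
  total′ x′∈xs with total (there x′∈xs)
  ... | y′ , y′∈ , Rx′y′ with ∈-++⁻ as y′∈
  ... | inj₁ y′∈as         = y′ , ∈-++⁺ˡ y′∈as , Rx′y′
  ... | inj₂ (here refl)   = contradiction (inj Rxy Rx′y′) (All.lookup x≢ x′∈xs)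
  ... | inj₂ (there y′∈bs) = y′ , ∈-++⁺ʳ as y′∈bs , Rx′y′

length-cartesianProduct : ∀ {a b} {A : Set a} {B : Set b} (xs : List A) (ys : List B) →
  length (cartesianProduct xs ys) ≡ length xs * length ys
length-cartesianProduct []       ys = refl
length-cartesianProduct (x ∷ xs) ys = begin
  length (map (x ,_) ys ++ cartesianProduct xs ys)
    ≡⟨ length-++ (map (x ,_) ys) ⟩
  length (map (x ,_) ys) + length (cartesianProduct xs ys)
    ≡⟨ cong₂ _+_ (length-map (x ,_) ys) (length-cartesianProduct xs ys) ⟩
  length ys + length xs * length ys ∎
  where open ≡-Reasoning

-- If every `f y` were shorter than `N`, the sum of the lengths would fall below `length xs * N`.
-- The membership `x ∈ˡ xs` excludes the empty list, where the inequality reads 0 ≤ 0.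
averaging : ∀ {a b} {A : Set a} {B : Set b} (f : A → List B) {N x xs} → x ∈ˡ xs →
  length xs * N ≤ length (concatMap f xs) → ∃ λ y → N ≤ length (f y)
averaging f {N} {xs = x ∷ xs} _ le with N ≤? length (f x)
... | yes N≤ = x , N≤
averaging f {N} {xs = x ∷ []} _ le | no N≰ =
  contradiction (subst₂ _≤_ (+-identityʳ N) (cong length (++-identityʳ (f x))) le) N≰
averaging f {N} {xs = x ∷ x′ ∷ xs} _ le | no N≰ = averaging f {xs = x′ ∷ xs} (here refl)
  (≮⇒≥ λ lt → <⇒≱ (+-mono-< (≰⇒> N≰) lt)
    (subst (N + length (x′ ∷ xs) * N ≤_) (length-++ (f x)) le))

bools : List Bool
bools = true ∷ false ∷ []

∈-bools : ∀ b → b ∈ˡ bools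
∈-bools true  = here refl
∈-bools false = there (here refl)

allSubsets-complete : ∀ {k} (B : Subset k) → B ∈ˡ allSubsets k
allSubsets-complete []          = here refl
allSubsets-complete (true ∷ B)  = ∈-++⁺ˡ (∈-map⁺ _ (allSubsets-complete B))
allSubsets-complete (false ∷ B) = ∈-++⁺ʳ _ (∈-map⁺ _ (allSubsets-complete B))

allSubsets-unique : ∀ k → Unique (allSubsets k)
allSubsets-unique zero    = [] ∷ []
allSubsets-unique (suc k) = Uniqueₚ.++⁺
  (Uniqueₚ.map⁺ ∷-injectiveʳ (allSubsets-unique k))
  (Uniqueₚ.map⁺ ∷-injectiveʳ (allSubsets-unique k))
  λ (p , q) → let _ , _ , eq = ∈-map⁻ _ p ; _ , _ , eq′ = ∈-map⁻ _ q
              in case ∷-injectiveˡ (trans (sym eq) eq′) of λ ()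

-- Intents

and-map⁻ : ∀ {A : Set} (f : A → Bool) {xs} → and (map f xs) ≡ true → ∀ {x} → x ∈ˡ xs → f x ≡ true
and-map⁻ f {x ∷ xs} eq (here refl) = ∧-conicalˡ (f x) _ eq
and-map⁻ f {x ∷ xs} eq (there x∈)  = and-map⁻ f (∧-conicalʳ (f x) _ eq) x∈

and-map⁺ : ∀ {A : Set} (f : A → Bool) xs → (∀ {x} → x ∈ˡ xs → f x ≡ true) → and (map f xs) ≡ true
and-map⁺ f []       h = refl
and-map⁺ f (x ∷ xs) h = cong₂ _∧_ (h (here refl)) (and-map⁺ f xs (h ∘ there))

module _ {n m} (I : Context n m) (A : Subset n) where

  ∈-up⁻ : ∀ {y} → y ∈ up I A → ∀ {x} → x ∈ A → I x y ≡ true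
  ∈-up⁻ {y} y∈ {x} x∈A
    with and-map⁻ (λ x → not (lookup A x) ∨ I x y)
           (trans (sym (lookup∘tabulate _ y)) ([]=⇒lookup y∈)) (∈-allFin x)
  ... | eq rewrite []=⇒lookup x∈A = eq

  ∈-up⁺ : ∀ {y} → (∀ {x} → x ∈ A → I x y ≡ true) → y ∈ up I A
  ∈-up⁺ {y} h = lookup⇒[]= y _
    (trans (lookup∘tabulate _ y) (and-map⁺ _ (allFin n) λ {x} _ → cell x (lookup A x) refl))
    where
    cell : ∀ x a → lookup A x ≡ a → not a ∨ I x y ≡ true
    cell x true  eq = h (lookup⇒[]= x A eq)
    cell x false eq = refl

-- A concept is determined by its intent, so concepts are counted through attribute sets alone. The
-- generating set `A` may be any object set, closed or not.
IsIntent : ∀ {n m} → Context n m → Subset m → Set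
IsIntent I B = ∃ λ A → up I A ≡ B

isIntent? : ∀ {n m} (I : Context n m) → Decidable (IsIntent I)
isIntent? I B = anySubset? λ A → ≡-dec _≟ᵇ_ (up I A) B

intents : ∀ {n m} → Context n m → List (Subset m)
intents I = filter (isIntent? I) (allSubsets _)

intents-unique : ∀ {n m} (I : Context n m) → Unique (intents I)
intents-unique I = Uniqueₚ.filter⁺ (isIntent? I) (allSubsets-unique _)

∈-intents⁺ : ∀ {n m} {I : Context n m} {B} → IsIntent I B → B ∈ˡ intents I
∈-intents⁺ {I = I} = ∈-filter⁺ (isIntent? I) (allSubsets-complete _)

∈-intents⁻ : ∀ {n m} {I : Context n m} {B} → B ∈ˡ intents I → IsIntent I B
∈-intents⁻ {I = I} = proj₂ ∘ ∈-filter⁻ (isIntent? I) {xs = allSubsets _}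

-- The usual identity for derivations: applying `up`, `down`, `up` gives `up`. Since `down I` is
-- definitionally `up (flip I)`, the membership lemmas for `up` serve both directions.
intent⇒concept : ∀ {n m} (I : Context n m) {B} → IsIntent I B → IsConcept I (down I B , B)
intent⇒concept I (A , refl) = ⊆-antisym
  (λ y∈ → ∈-up⁺ I A λ x∈A →
    ∈-up⁻ I _ y∈ (∈-up⁺ (flip I) (up I A) λ z∈ → ∈-up⁻ I A z∈ x∈A))
  (λ y∈ → ∈-up⁺ I _ λ x∈ → ∈-up⁻ (flip I) (up I A) x∈ y∈) , refl

module _ {n m} (I : Context n m) where

  private
    pairs = cartesianProduct (allSubsets n) (allSubsets m)
    concepts = filter (isConcept? I) pairs

  numConcepts≤intents : numConcepts I ≤ length (intents I)
  numConcepts≤intents = length-≤ (λ (A , B) B′ → B ≡ B′ × down I B ≡ A) {concepts}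
    (Uniqueₚ.filter⁺ (isConcept? I) (Uniqueₚ.cartesianProduct⁺ (allSubsets-unique n) (allSubsets-unique m)))
    (λ {p} p∈ → let up≡ , down≡ = proj₂ (∈-filter⁻ (isConcept? I) {xs = pairs} p∈)
                in proj₂ p , ∈-intents⁺ {I = I} (proj₁ p , up≡) , refl , down≡)
    (λ { (refl , refl) (refl , refl) → refl })

  intents≤numConcepts : length (intents I) ≤ numConcepts I
  intents≤numConcepts = length-≤ (λ B p → B ≡ proj₂ p) {ys = concepts} (intents-unique I)
    (λ {B} B∈ → _ , ∈-filter⁺ (isConcept? I)
       (∈-cartesianProduct⁺ (allSubsets-complete _) (allSubsets-complete _))
       (intent⇒concept I (∈-intents⁻ {I = I} B∈)) , refl)
    (λ { refl refl → refl })

-- Contexts are functions, and a context decoded from its table agrees with the original only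
-- pointwise.
numConcepts-cong : ∀ {n m} {I J : Context n m} → (∀ x y → I x y ≡ J x y) → numConcepts I ≤ numConcepts J
numConcepts-cong {I = I} {J} I≗J = begin
  numConcepts I       ≤⟨ numConcepts≤intents I ⟩
  length (intents I)  ≤⟨ length-≤ _≡_ (intents-unique I)
                           (λ {B} B∈ → B , ∈-intents⁺ {I = J} (transport (∈-intents⁻ {I = I} B∈)) , refl)
                           (λ { refl refl → refl }) ⟩
  length (intents J)  ≤⟨ intents≤numConcepts J ⟩
  numConcepts J       ∎
  where
  open ≤-Reasoning
  transport : ∀ {B} → IsIntent I B → IsIntent J B
  transport (A , refl) = A , ⊆-antisym
    (λ y∈ → ∈-up⁺ I A λ x∈ → trans (I≗J _ _) (∈-up⁻ J A y∈ x∈))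
    (λ y∈ → ∈-up⁺ J A λ x∈ → trans (sym (I≗J _ _)) (∈-up⁻ I A y∈ x∈))

-- Deleting an object and an attribute

delete : ∀ {n m} → Context (suc n) (suc m) → Fin (suc n) → Context n m
delete I g h y = I (punchIn g h) (suc y)

module _ {n m} (I : Context (suc n) (suc m)) where

  private
    J : Context (suc n) m
    J h y = I h (suc y)

    row : Fin (suc n) → Subset m
    row g = tabulate (J g)

    ∈-row⁺ : ∀ {g y} → J g y ≡ true → y ∈ row g
    ∈-row⁺ {g} {y} eq = lookup⇒[]= y _ (trans (lookup∘tabulate _ y) eq)

    ∈-row⁻ : ∀ {g y} → y ∈ row g → J g y ≡ true
    ∈-row⁻ {g} {y} y∈ = trans (sym (lookup∘tabulate _ y)) ([]=⇒lookup y∈)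

    up-∪⁅⁆ : ∀ A g → up J (A ∪ ⁅ g ⁆) ≡ up J A ∩ row g
    up-∪⁅⁆ A g = ⊆-antisym
      (λ y∈ → x∈p∩q⁺
        ( ∈-up⁺ J A (λ x∈A → ∈-up⁻ J (A ∪ ⁅ g ⁆) y∈ (x∈p∪q⁺ (inj₁ x∈A)))
        , ∈-row⁺ (∈-up⁻ J (A ∪ ⁅ g ⁆) y∈ (x∈p∪q⁺ (inj₂ (x∈⁅x⁆ g))))))
      (λ y∈ → let y∈up , y∈row = x∈p∩q⁻ (up J A) (row g) y∈ in
        ∈-up⁺ J (A ∪ ⁅ g ⁆) λ x∈ → case x∈p∪q⁻ A ⁅ g ⁆ x∈ of λ
        { (inj₁ x∈A) → ∈-up⁻ J A y∈up x∈A
        ; (inj₂ x∈g) → subst (λ z → J z _ ≡ true) (sym (x∈⁅y⁆⇒x≡y g x∈g)) (∈-row⁻ y∈row) })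

    -- These are the intents of `delete I g`, expressed through object sets of the whole context so
    -- that different `g` can be compared without reindexing.
    Avoids : Fin (suc n) → Subset m → Set
    Avoids g B = ∃ λ A → ¬ (g ∈ A) × up J A ≡ B

    avoids? : ∀ g → Decidable (Avoids g)
    avoids? g B = anySubset? λ A → ¬? (g ∈? A) ×-dec ≡-dec _≟ᵇ_ (up J A) B

    avoids⇒intent : ∀ {g B} → Avoids g B → IsIntent (delete I g) B
    avoids⇒intent {g} (A , g∉A , refl) = A′ , ⊆-antisym
      (λ y∈ → ∈-up⁺ J A λ {h} h∈A →
        let g≢h = λ { refl → g∉A h∈A }
            h≡ = punchIn-punchOut g≢h
        in subst (λ z → J z _ ≡ true) h≡
             (∈-up⁻ (delete I g) A′ y∈ (∈A′⁺ (subst (_∈ A) (sym h≡) h∈A))))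
      (λ y∈ → ∈-up⁺ (delete I g) A′ λ h∈ → ∈-up⁻ J A y∈ (∈A′⁻ h∈))
      where
      A′ = tabulate (lookup A ∘ punchIn g)
      ∈A′⁺ : ∀ {h} → punchIn g h ∈ A → h ∈ A′
      ∈A′⁺ {h} h∈ = lookup⇒[]= h A′ (trans (lookup∘tabulate _ h) ([]=⇒lookup h∈))
      ∈A′⁻ : ∀ {h} → h ∈ A′ → punchIn g h ∈ A
      ∈A′⁻ {h} h∈ = lookup⇒[]= _ A (trans (sym (lookup∘tabulate _ h)) ([]=⇒lookup h∈))

    With Without : Subset m → Set
    With    C = IsIntent I (true ∷ C)
    Without C = IsIntent I (false ∷ C)

    with⇒⊆column : ∀ {A C} → up I A ≡ true ∷ C → ∀ {h} → h ∈ A → I h zero ≡ true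
    with⇒⊆column {A} eq = ∈-up⁻ I A (subst (zero ∈_) (sym eq) here)

    without⇒⊈column : ∀ {A C} → up I A ≡ false ∷ C → ∃ λ h → h ∈ A × I h zero ≡ false
    without⇒⊈column {A} eq with any? (λ h → (h ∈? A) ×-dec (I h zero ≟ᵇ false))
    ... | yes h∈ = h∈
    ... | no ¬h∈ = case subst (zero ∈_) eq (∈-up⁺ I A {zero} λ h∈A → ¬-not λ eq → ¬h∈ (_ , h∈A , eq)) of λ ()

    with⇒avoids : ∀ {g C} → I g zero ≡ false → With C → Avoids g C
    with⇒avoids gx (A , eq) =
      A , (λ g∈A → not-¬ (with⇒⊆column eq g∈A) gx) , ∷-injectiveʳ eq

    -- A generator of an intent containing attribute zero has only objects incident to zero, hence
    -- not `h`. Adjoining `g` keeps `h` out and intersects the intent with `row g`.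
    with-∩-avoids : ∀ {g h C} → With C → g ≢ h → I h zero ≡ false → Avoids h (C ∩ row g)
    with-∩-avoids {g} {h} W g≢h hx with with⇒avoids hx W
    ... | A , h∉A , refl = A ∪ ⁅ g ⁆ ,
      (λ h∈ → case x∈p∪q⁻ A ⁅ g ⁆ h∈ of λ
        { (inj₁ h∈A) → h∉A h∈A ; (inj₂ h∈g) → g≢h (sym (x∈⁅y⁆⇒x≡y g h∈g)) }) ,
      up-∪⁅⁆ A g

    -- Object g, missing attribute zero, is to be deleted. An intent of I is copied to its trace on
    -- the other attributes while that trace is still an intent without g. Otherwise the trace is
    -- C ∩ row g for an intent C avoiding g, and it moves to a free one of the two copies of C. If
    -- neither is free, some h missing attribute zero has C ⊆ row h, and the trace is an intent
    -- avoiding h whose "true" copy at h is free.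
    data _↦_ : Fin (suc n) × Subset (suc m) → Fin (suc n) × (Bool × Subset m) → Set where
      with-stays    : ∀ {g B} → I g zero ≡ false → With B → (g , true ∷ B) ↦ (g , true , B)
      without-stays : ∀ {g B} → Avoids g B → Without B → (g , false ∷ B) ↦ (g , false , B)
      to-with       : ∀ {g B C} → I g zero ≡ false → ¬ Avoids g B → B ≡ C ∩ row g → ¬ With C →
                      (g , false ∷ B) ↦ (g , true , C)
      to-without    : ∀ {g B C} → ¬ Avoids g B → B ≡ C ∩ row g → ¬ Without C →
                      (g , false ∷ B) ↦ (g , false , C)
      switch        : ∀ {g h B C} → I g zero ≡ false → ¬ Avoids g B → B ≡ C ∩ row g → With C →
                      I h zero ≡ false → C ⊆ row h → g ≢ h → (g , false ∷ B) ↦ (h , true , B)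

    ∩-absorb : ∀ {B C g h} → B ≡ C ∩ row g → C ⊆ row h → B ∩ row h ≡ B
    ∩-absorb {C = C} {g} refl C⊆ = ⊆-antisym (λ y∈ → proj₁ (x∈p∩q⁻ _ _ y∈))
      (λ y∈ → x∈p∩q⁺ (y∈ , C⊆ (proj₁ (x∈p∩q⁻ C (row g) y∈))))

    -- Keeps `to-with` and `switch` from sharing a target: `B′` would equal `B`, which is
    -- `C ∩ row g` and so avoids `h`.
    clash : ∀ {g h B B′ C} → ¬ Avoids h B′ → B′ ≡ B ∩ row h →
      B ≡ C ∩ row g → With C → I h zero ≡ false → C ⊆ row h → ¬ (g ≢ h)
    clash ¬av refl B≡ W hx C⊆ g≢h =
      ¬av (subst (Avoids _) (sym (trans (∩-absorb B≡ C⊆) B≡)) (with-∩-avoids W g≢h hx))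

    -- A copy is either occupied by an intent that stays or free for one that moves, never both.
    -- With bit `true`, `switch` competes as well: against `with-stays`, `With B` would make `B`
    -- avoid `g`; against `to-with`, `clash` applies.
    ↦-injective : ∀ {s s′ t} → s ↦ t → s′ ↦ t → s ≡ s′
    ↦-injective (with-stays _ _)      (with-stays _ _)          = refl
    ↦-injective (with-stays _ W)      (to-with _ _ _ ¬W)        = contradiction W ¬W
    ↦-injective (with-stays _ W)      (switch gx ¬av _ _ _ _ _) = contradiction (with⇒avoids gx W) ¬av
    ↦-injective (to-with _ _ _ ¬W)    (with-stays _ W)          = contradiction W ¬W
    ↦-injective (to-with _ _ refl _)  (to-with _ _ refl _)      = refl
    ↦-injective (to-with _ ¬av B≡ _)  (switch _ _ B≡′ W hx C⊆ g≢h) =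
      contradiction g≢h (clash ¬av B≡ B≡′ W hx C⊆)
    ↦-injective (switch gx ¬av _ _ _ _ _) (with-stays _ W)      = contradiction (with⇒avoids gx W) ¬av
    ↦-injective (switch _ _ B≡′ W hx C⊆ g≢h) (to-with _ ¬av B≡ _) =
      contradiction g≢h (clash ¬av B≡ B≡′ W hx C⊆)
    -- Two switches to the same target have the same trace `C ∩ row g`. If `g′` differed from `g`,
    -- this trace would avoid `g′`, contrary to the second switch.
    ↦-injective (switch {g} _ _ refl W _ _ _) (switch {g′} g′x ¬av _ _ _ _ _) with g ≟ g′
    ... | yes refl = refl
    ... | no g≢g′  = contradiction (with-∩-avoids W g≢g′ g′x) ¬av
    ↦-injective (without-stays _ _)   (without-stays _ _)       = refl
    ↦-injective (without-stays _ W)   (to-without _ _ ¬W)       = contradiction W ¬W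
    ↦-injective (to-without _ _ ¬W)   (without-stays _ W)       = contradiction W ¬W
    ↦-injective (to-without _ refl _) (to-without _ refl _)     = refl

    ↦-total : ∀ {g B} → I g zero ≡ false → IsIntent I B →
      ∃₂ λ g′ b → ∃ λ B′ → I g′ zero ≡ false × Avoids g′ B′ × ((g , B) ↦ (g′ , b , B′))
    ↦-total {g} {true ∷ B} gx W = g , true , B , gx , with⇒avoids gx W , with-stays gx W
    ↦-total {g} {false ∷ B} gx W with avoids? g B
    ... | yes av = g , false , B , gx , av , without-stays av W
    ↦-total {g} {false ∷ B} gx (A , up≡) | no ¬av = split (isIntent? I (true ∷ C)) (isIntent? I (false ∷ C))
      where
      -- As `B` does not avoid `g`, its generator `A` contains `g`. Removing `g` gives the intent
      -- `C` with `B ≡ C ∩ row g`.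
      A₀ = A ∩ ∁ ⁅ g ⁆
      C = up J A₀

      g∉A₀ : ¬ (g ∈ A₀)
      g∉A₀ g∈ = x∈∁p⇒x∉p (proj₂ (x∈p∩q⁻ A _ g∈)) (x∈⁅x⁆ g)

      g∈A : g ∈ A
      g∈A with g ∈? A
      ... | yes g∈ = g∈
      ... | no g∉  = contradiction (A , g∉ , ∷-injectiveʳ up≡) ¬av

      B≡ : B ≡ C ∩ row g
      B≡ = trans (sym (∷-injectiveʳ up≡)) (trans (cong (up J) A≡) (up-∪⁅⁆ A₀ g))
        where
        A≡ : A ≡ A₀ ∪ ⁅ g ⁆
        A≡ = ⊆-antisym
          (λ {x} x∈A → case x ≟ g of λ
            { (yes refl) → x∈p∪q⁺ (inj₂ (x∈⁅x⁆ g))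
            ; (no x≢g) → x∈p∪q⁺ (inj₁ (x∈p∩q⁺ (x∈A , x∉p⇒x∈∁p (x≢y⇒x∉⁅y⁆ x≢g)))) })
          (λ x∈ → case x∈p∪q⁻ A₀ ⁅ g ⁆ x∈ of λ
            { (inj₁ x∈A₀) → proj₁ (x∈p∩q⁻ A _ x∈A₀)
            ; (inj₂ x∈g) → subst (_∈ A) (sym (x∈⁅y⁆⇒x≡y g x∈g)) g∈A })

      split : Dec (With C) → Dec (Without C) → _
      split (no ¬W) _        = g , true , C , gx , (A₀ , g∉A₀ , refl) , to-with gx ¬av B≡ ¬W
      split (yes W) (no ¬W′) = g , false , C , gx , (A₀ , g∉A₀ , refl) , to-without ¬av B≡ ¬W′
      -- Both copies of `C` are occupied. The generator `A′` of the copy without attribute zero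
      -- contains some `h` missing zero, and `C ⊆ row h` because `h ∈ A′`. If `h` were `g`, then `B`
      -- would equal `C`, which avoids `g`.
      split (yes W) (yes (A′ , up≡′)) with without⇒⊈column up≡′
      ... | h , h∈A′ , hx = h , true , B , hx ,
              subst (Avoids h) (sym B≡) (with-∩-avoids W g≢h hx) ,
              switch gx ¬av B≡ W hx C⊆ g≢h
        where
        C⊆ : C ⊆ row h
        C⊆ y∈ = ∈-row⁺ (∈-up⁻ J A′ (subst (_ ∈_) (sym (∷-injectiveʳ up≡′)) y∈) h∈A′)
        g≢h : g ≢ h
        g≢h refl = ¬av (A₀ , g∉A₀ , trans C≡ (sym B≡))
          where
          C≡ : C ≡ C ∩ row g
          C≡ = ⊆-antisym (λ y∈ → x∈p∩q⁺ (y∈ , C⊆ y∈)) (λ y∈ → proj₁ (x∈p∩q⁻ C _ y∈))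

    missing? : Decidable (λ g → I g zero ≡ false)
    missing? g = I g zero ≟ᵇ false

    missing : List (Fin (suc n))
    missing = filter missing? (allFin (suc n))

    fibre : Fin (suc n) → List (Fin (suc n) × (Bool × Subset m))
    fibre g = map (g ,_) (cartesianProduct bools (intents (delete I g)))

  -- Summed over all objects missing attribute zero, `_↦_` injects the copies of `intents I` into
  -- the fibres, so some fibre is at least as long as `intents I`. The factor 2 is the length of
  -- `bools`.
  halving-missing : ∀ {g} → I g zero ≡ false →
    ∃ λ h → length (intents I) ≤ 2 * length (intents (delete I h))
  halving-missing {g} gx =
    let h , le = averaging fibre (∈-missing⁺ gx)
                   (subst (_≤ length (concatMap fibre missing))
                     (length-cartesianProduct missing (intents I))
                     (length-≤ _↦_ unique total ↦-injective))
        hs = intents (delete I h)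
    in h , ≤-trans le (≤-reflexive
         (trans (length-map (h ,_) (cartesianProduct bools hs)) (length-cartesianProduct bools hs)))
    where
    unique : Unique (cartesianProduct missing (intents I))
    unique = Uniqueₚ.cartesianProduct⁺
      (Uniqueₚ.filter⁺ missing? (Uniqueₚ.allFin⁺ (suc n))) (intents-unique I)

    ∈-missing⁺ : ∀ {g} → I g zero ≡ false → g ∈ˡ missing
    ∈-missing⁺ {g} = ∈-filter⁺ missing? (∈-allFin g)

    total : ∀ {s} → s ∈ˡ cartesianProduct missing (intents I) →
      ∃ λ t → t ∈ˡ concatMap fibre missing × s ↦ t
    total s∈ with ∈-cartesianProduct⁻ missing (intents I) s∈
    ... | g∈ , B∈ with ↦-total (proj₂ (∈-filter⁻ missing? {xs = allFin _} g∈)) (∈-intents⁻ {I = I} B∈)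
    ... | h , b , B′ , hx , av , s↦t = (h , b , B′) ,
      ∈-concatMap⁺ fibre (lose (∈-missing⁺ hx) (∈-map⁺ (h ,_)
        (∈-cartesianProduct⁺ (∈-bools b) (∈-intents⁺ {I = delete I h} (avoids⇒intent av))))) , s↦t

-- Handles an attribute that no object misses. After clearing, every object misses it, while each
-- `delete I g` is definitionally unchanged and no intents are lost: a full column adds the same bit
-- to every intent, so the traces already tell the intents apart.
clearColumn : ∀ {n m} → Context n (suc m) → Context n (suc m)
clearColumn I x zero    = false
clearColumn I x (suc y) = I x (suc y)

intents-clearColumn : ∀ {n m} (I : Context n (suc m)) → (∀ x → I x zero ≡ true) →
  length (intents I) ≤ length (intents (clearColumn I))
intents-clearColumn I full = length-≤ (λ B B′ → ∃₂ λ C b → B ≡ true ∷ C × B′ ≡ b ∷ C)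
  (intents-unique I) total λ { (_ , _ , refl , refl) (_ , _ , refl , refl) → refl }
  where
  total : ∀ {B} → B ∈ˡ intents I →
    ∃ λ B′ → B′ ∈ˡ intents (clearColumn I) × ∃₂ λ C b → B ≡ true ∷ C × B′ ≡ b ∷ C
  total B∈ with ∈-intents⁻ {I = I} B∈
  ... | A , refl = _ , ∈-intents⁺ {I = clearColumn I} (A , refl) ,
    tail (up I A) , _ , cong (_∷ tail (up I A)) ([]=⇒lookup (∈-up⁺ I A {zero} λ _ → full _)) , refl

halving : ∀ {n m} (I : Context (suc n) (suc m)) → ∃ λ g → numConcepts I ≤ 2 * numConcepts (delete I g)
halving I = let g , le = intents-halving in g , (begin
  numConcepts I                        ≤⟨ numConcepts≤intents I ⟩
  length (intents I)                   ≤⟨ le ⟩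
  2 * length (intents (delete I g))    ≤⟨ *-monoʳ-≤ 2 (intents≤numConcepts (delete I g)) ⟩
  2 * numConcepts (delete I g)         ∎)
  where
  open ≤-Reasoning
  intents-halving : ∃ λ g → length (intents I) ≤ 2 * length (intents (delete I g))
  intents-halving with any? (λ g → I g zero ≟ᵇ false)
  ... | yes (g , gx) = halving-missing I gx
  ... | no ¬missing  =
    let g , le = halving-missing (clearColumn I) {zero} refl
    in g , ≤-trans (intents-clearColumn I λ x → ¬-not λ eq → ¬missing (x , eq)) le

-- Adjoining an object and an attribute

-- The direct sum of `I` with the contranominal scale of size one.
extend : ∀ {n m} → Context n m → Context (suc n) (suc m)
extend I zero    zero    = false
extend I zero    (suc y) = true
extend I (suc x) zero    = true
extend I (suc x) (suc y) = I x y

-- The new object excludes only the new attribute, hence the `not b`; the old objects never exclude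
-- it. The new bit of an intent can thus be chosen freely.
up-extend : ∀ {n m} (I : Context n m) A b → up (extend I) (not b ∷ A) ≡ b ∷ up I A
up-extend I A b = ⊆-antisym (fwd b) (bwd b)
  where
  fwd : ∀ b → up (extend I) (not b ∷ A) ⊆ b ∷ up I A
  fwd true  {zero}  y∈ = here
  fwd false {zero}  y∈ = case ∈-up⁻ (extend I) (true ∷ A) y∈ here of λ ()
  fwd b     {suc y} y∈ = there (∈-up⁺ I A λ x∈ → ∈-up⁻ (extend I) (not b ∷ A) y∈ (there x∈))
  bwd : ∀ b → b ∷ up I A ⊆ up (extend I) (not b ∷ A)
  bwd true  here       = ∈-up⁺ (extend I) (false ∷ A) λ { (there x∈) → refl }
  bwd b     (there y∈) = ∈-up⁺ (extend I) (not b ∷ A) λ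
    { {zero} _ → refl ; {suc x} (there x∈) → ∈-up⁻ I A y∈ x∈ }

doubling : ∀ {n m} (I : Context n m) → 2 * numConcepts I ≤ numConcepts (extend I)
doubling I = begin
  2 * numConcepts I                              ≤⟨ *-monoʳ-≤ 2 (numConcepts≤intents I) ⟩
  2 * length (intents I)                         ≡⟨ length-cartesianProduct bools (intents I) ⟨
  length (cartesianProduct bools (intents I))    ≤⟨ length-≤ (λ (b , B) B′ → B′ ≡ b ∷ B)
                                                      unique total (λ { refl refl → refl }) ⟩
  length (intents (extend I))                    ≤⟨ intents≤numConcepts (extend I) ⟩
  numConcepts (extend I)                         ∎
  where
  open ≤-Reasoning
  unique : Unique (cartesianProduct bools (intents I))
  unique = Uniqueₚ.cartesianProduct⁺ (((λ ()) ∷ []) ∷ [] ∷ []) (intents-unique I)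

  total : ∀ {p} → p ∈ˡ cartesianProduct bools (intents I) →
    ∃ λ B′ → B′ ∈ˡ intents (extend I) × B′ ≡ proj₁ p ∷ proj₂ p
  total {b , B} p∈ with ∈-intents⁻ {I = I} (proj₂ (∈-cartesianProduct⁻ bools (intents I) p∈))
  ... | A , refl = b ∷ B , ∈-intents⁺ {I = extend I} (not b ∷ A , up-extend I A b) , refl

-- Contranominal scales

Scale : ∀ {n m j} → Context n m → (Fin j → Fin n) → (Fin j → Fin m) → Set
Scale I f g = ∀ a b → (I (f a) (g b) ≡ true → a ≢ b) × (a ≢ b → I (f a) (g b) ≡ true)

scale? : ∀ {n m j} (I : Context n m) (f : Fin j → Fin n) (g : Fin j → Fin m) → Dec (Scale I f g)
scale? I f g = all? λ a → all? λ b →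
  ((I (f a) (g b) ≟ᵇ true) →-dec ¬? (a ≟ b)) ×-dec (¬? (a ≟ b) →-dec (I (f a) (g b) ≟ᵇ true))

scale-resp : ∀ {n m n′ m′ j} {I : Context n m} {I′ : Context n′ m′}
  {f : Fin j → Fin n} {g : Fin j → Fin m} {f′ : Fin j → Fin n′} {g′ : Fin j → Fin m′} →
  (∀ a b → I (f a) (g b) ≡ I′ (f′ a) (g′ b)) → Scale I f g → Scale I′ f′ g′
scale-resp eq S a b rewrite sym (eq a b) = S a b

-- For distinct `a` and `b`, the object `f a` has attribute `g b` but `f b` does not, so `f a` and
-- `f b` differ; dually for `g`.
scale⇒contains : ∀ {n m j} (I : Context n m) (f : Fin j → Fin n) (g : Fin j → Fin m) →
  Scale I f g → ContainsContranominal j I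
scale⇒contains I f g S = f , g ,
  (λ {a} {b} fa≡fb → decidable-stable (a ≟ b) λ a≢b →
    proj₁ (S b b) (subst (λ x → I x (g b) ≡ true) fa≡fb (proj₂ (S a b) a≢b)) refl) ,
  (λ {a} {b} ga≡gb → decidable-stable (a ≟ b) λ a≢b →
    proj₁ (S a a) (subst (λ y → I (f a) y ≡ true) (sym ga≡gb) (proj₂ (S a b) a≢b)) refl) ,
  S

-- Exhaustive search over the finitely many pairs of functions, each coded as an element of a finite
-- type. Decoding returns a function only up to pointwise equality, which `scale-resp` absorbs.
contains? : ∀ {n m} j (I : Context n m) → Dec (ContainsContranominal j I)
contains? {n} {m} j I = map′
  (λ (p , q , S) → scale⇒contains I (finToFun p) (finToFun q) S)
  (λ (f , g , _ , _ , S) → funToFin f , funToFin g ,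
    scale-resp {I = I} {I} {f} {g} {finToFun (funToFin f)} {finToFun (funToFin g)}
      (λ a b → sym (cong₂ I (finToFun-funToFin f a) (finToFun-funToFin g b))) S)
  (any? λ p → any? λ q → scale? I (finToFun {n} {j} p) (finToFun {m} {j} q))

contains-cong : ∀ {n m j} {I J : Context n m} → (∀ x y → I x y ≡ J x y) →
  ContainsContranominal j I → ContainsContranominal j J
contains-cong {I = I} {J} I≗J (f , g , _ , _ , S) =
  scale⇒contains J f g (scale-resp {I = I} {J} {f} {g} {f} {g} (λ a b → I≗J (f a) (g b)) S)

contains-delete : ∀ {n m j} (I : Context (suc n) (suc m)) h →
  ContainsContranominal j (delete I h) → ContainsContranominal j I
contains-delete I h (f , g , _ , _ , S) =
  scale⇒contains I (punchIn h ∘ f) (suc ∘ g) S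

contains-extend⁺ : ∀ {n m j} (I : Context n m) →
  ContainsContranominal j I → ContainsContranominal (suc j) (extend I)
contains-extend⁺ {n} {m} {j} I (f , g , _ , _ , S) = scale⇒contains (extend I) (cons f) (cons g) S′
  where
  cons : ∀ {k} → (Fin j → Fin k) → Fin (suc j) → Fin (suc k)
  cons f zero    = zero
  cons f (suc a) = suc (f a)
  S′ : Scale (extend I) (cons f) (cons g)
  S′ zero    zero    = (λ ()) , contradiction refl
  S′ zero    (suc b) = (λ _ ()) , λ _ → refl
  S′ (suc a) zero    = (λ _ ()) , λ _ → refl
  S′ (suc a) (suc b) = (λ eq → proj₁ (S a b) eq ∘ suc-injective) ,
                       λ a≢b → proj₂ (S a b) (a≢b ∘ cong suc)

extend-column : ∀ {n m} (I : Context n m) {x y} → extend I x y ≡ false → y ≡ zero → x ≡ zero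
extend-column I {zero} {zero} eq refl = refl

nonzero⇒suc : ∀ {n} {i : Fin (suc n)} → i ≢ zero → ∃ λ j → i ≡ suc j
nonzero⇒suc {i = zero}  i≢0 = contradiction refl i≢0
nonzero⇒suc {i = suc j} _   = j , refl

-- Drop the index whose object is the new one. The other indices also use old attributes: each
-- diagonal entry is `false`, and the new attribute misses only the new object.
contains-extend⁻ : ∀ {n m j} (I : Context n m) →
  ContainsContranominal (suc j) (extend I) → ContainsContranominal j I
contains-extend⁻ {n} {m} {j} I (f , g , f-inj , _ , S) = avoiding (locate (any? λ a → f a ≟ zero))
  where
  diagonal : ∀ a → extend I (f a) (g a) ≡ false
  diagonal a = ¬-not λ eq → proj₁ (S a a) eq refl

  locate : Dec (∃ λ a → f a ≡ zero) → ∃ λ a₀ → ∀ a → a ≢ a₀ → f a ≢ zero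
  locate (yes (a₀ , eq)) = a₀ , λ a a≢a₀ eq′ → a≢a₀ (f-inj (trans eq′ (sym eq)))
  -- The new object does not occur, so any index may be dropped.
  locate (no f≢0)        = zero , λ a _ eq → f≢0 (a , eq)

  avoiding : (∃ λ a₀ → ∀ a → a ≢ a₀ → f a ≢ zero) → ContainsContranominal j I
  avoiding (a₀ , f≢0) = scale⇒contains I (proj₁ ∘ f-suc) (proj₁ ∘ g-suc)
    (scale-resp {I = extend I} {I} {f ∘ punchIn a₀} {g ∘ punchIn a₀} {proj₁ ∘ f-suc} {proj₁ ∘ g-suc}
      (λ a b → cong₂ (extend I) (proj₂ (f-suc a)) (proj₂ (g-suc b))) S′)
    where
    f-suc : ∀ a → ∃ λ x → f (punchIn a₀ a) ≡ suc x
    f-suc a = nonzero⇒suc (f≢0 _ (punchInᵢ≢i a₀ a))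
    g-suc : ∀ a → ∃ λ y → g (punchIn a₀ a) ≡ suc y
    g-suc a = nonzero⇒suc (f≢0 _ (punchInᵢ≢i a₀ a) ∘ extend-column I (diagonal _))
    S′ : Scale (extend I) (f ∘ punchIn a₀) (g ∘ punchIn a₀)
    S′ a b = (λ eq → proj₁ (S _ _) eq ∘ cong (punchIn a₀)) ,
             λ a≢b → proj₂ (S _ _) (a≢b ∘ punchIn-injective a₀ a b)

-- Reaching a scale of the desired size

-- Induction on `j`. If `I` has no scale of size `suc j`, neither has `delete I g`, so the induction
-- hypothesis applies to it. `extend` then raises the scale size by one and makes up for the factor
-- 2 lost in the deletion. The bounds on `j` provide an object and an attribute to delete.
attain : ∀ j {n m} (I : Context n m) → j ≤ n → j ≤ m → ¬ ContainsContranominal (suc j) I →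
  Σ (Context n m) λ L →
    ContainsContranominal j L × ¬ ContainsContranominal (suc j) L × numConcepts I ≤ numConcepts L
attain zero I _ _ free = I , scale⇒contains I (λ ()) (λ ()) (λ ()) , free , ≤-refl
attain (suc j) {suc n} {suc m} I (s≤s j≤n) (s≤s j≤m) free with contains? (suc j) I
... | yes has = I , has , free , ≤-refl
... | no ¬has with halving I
... | g , I≤ with attain j (delete I g) j≤n j≤m (¬has ∘ contains-delete I g)
... | L , has , L-free , ≤L = extend L , contains-extend⁺ L has , L-free ∘ contains-extend⁻ L , (begin
  numConcepts I                 ≤⟨ I≤ ⟩
  2 * numConcepts (delete I g)  ≤⟨ *-monoʳ-≤ 2 ≤L ⟩
  2 * numConcepts L             ≤⟨ doubling L ⟩
  numConcepts (extend L)        ∎)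
  where open ≤-Reasoning

-- Contexts with the most concepts

module _ (n m c : ℕ) where

  private
    -- Reads a bit vector as an incidence table, so that `allSubsets` enumerates all contexts up to
    -- pointwise equality.
    decode : Subset (n * m) → Context n m
    decode v x y = lookup v (combine x y)

    free? : Decidable (λ (I : Context n m) → ¬ ContainsContranominal (suc c) I)
    free? I = ¬? (contains? (suc c) I)

    -- The default value for `argmax`. It is admissible because a scale of size `suc c` has a
    -- diagonal entry, which must be `false`.
    full : Context n m
    full _ _ = true

    candidates : List (Context n m)
    candidates = filter free? (map decode (allSubsets (n * m)))

  maximal : Σ (Context n m) λ I → ¬ ContainsContranominal (suc c) I ×
    ((J : Context n m) → ¬ ContainsContranominal (suc c) J → numConcepts J ≤ numConcepts I)
  maximal = I , argmax-all numConcepts {P = λ I → ¬ ContainsContranominal (suc c) I} full-free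
                  (all-filter free? (map decode (allSubsets (n * m)))) , bound
    where
    I = argmax numConcepts full candidates

    full-free : ¬ ContainsContranominal (suc c) full
    full-free (_ , _ , _ , _ , S) = proj₁ (S zero zero) refl refl

    bound : ∀ J → ¬ ContainsContranominal (suc c) J → numConcepts J ≤ numConcepts I
    bound J free = ≤-trans (numConcepts-cong (λ x y → sym (decoded x y)))
      (All.lookup (f[xs]≤f[argmax] {f = numConcepts} full candidates)
        (∈-filter⁺ free? (∈-map⁺ decode (allSubsets-complete code)) (free ∘ contains-cong decoded)))
      where
      code : Subset (n * m)
      code = tabulate (uncurry J ∘ remQuot m)
      decoded : ∀ x y → decode code x y ≡ J x y
      decoded x y = trans (lookup∘tabulate _ (combine x y)) (cong (uncurry J) (remQuot-combine x y))

theorem5 : (n m c : ℕ) → 1 ≤ c → c ≤ (n ⊓ m) + 1 →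
    Σ (Context n m) λ I →
    ¬ ContainsContranominal c I ×
    ((J : Context n m) → ¬ ContainsContranominal c J → numConcepts J ≤ numConcepts I) ×
    ContainsContranominal (c ∸ 1) I
theorem5 n m (suc c) _ c≤ =
  let I , I-free , I-max       = maximal n m c
      c≤n⊓m                    = ≤-pred (subst (suc c ≤_) (+-comm (n ⊓ m) 1) c≤)
      L , L-has , L-free , I≤L = attain c I (≤-trans c≤n⊓m (m⊓n≤m n m)) (≤-trans c≤n⊓m (m⊓n≤n n m)) I-free
  in L , L-free , (λ J J-free → ≤-trans (I-max J J-free) I≤L) , L-has
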